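{- There is an absolute constant $C>0$ such that for all integers $n\ge 2$ and $d\ge 1$ the following holds. Let $G=(V,E)$ be an $n$-vertex directed acyclic graph with two special vertices $s,t\in V$, whose edge weights are of the form $$\mathsf{wt}(e)=a_{e,1}\lambda_1+a_{e,2}\lambda_2+\cdots+a_{e,d}\lambda_d+a_{e,d+1},\qquad a_{e,i}\in\mathbb{R}.$$ Then $$|\mathrm{MSPC}(G)|\le n^{C d\log n},$$ that is, $|\mathrm{MSPC}(G)|\in n^{O(d\log n)}$.
   Context: Graphs are simple (no multi-edges or self-loops) and connected, and there is at least one path from $s$ to $t$. Logarithms are to base 2. The parameters $\overline{\lambda}=(\lambda_1,\dots,\lambda_d)\in\mathbb{R}^d$ are common to the entire graph, while the coefficients $a_{e,i}$ are fixed real constants for each edge. The weight of a path $P$ from $s$ to $t$ is $\mathsf{wt}(P)=\sum_{e\in P}\mathsf{wt}(e)$, a function of $\overline{\lambda}$. Let $\mathcal{P}_{s,t}$ be the set of paths from $s$ to $t$ in $G$. A path $P\in\mathcal{P}_{s,t}$ is a shortest path at $\overline{\lambda}=\overline{x}$ if it is a shortest path from $s$ to $t$ in the fixed-edge-weight graph obtained by setting $\overline{\lambda}=\overline{x}$ in all edge weights. A Minimum Shortest Path Cover $\mathrm{MSPC}(G)$ is a minimum-sized subset $\mathcal{S}\subseteq\mathcal{P}_{s,t}$ such that for every $\overline{x}\in\mathbb{R}^d$ some path $P\in\mathcal{S}$ is a shortest path in $G$ at $\overline{\lambda}=\overline{x}$; $|\mathrm{MSPC}(G)|$ denotes its size.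 -}

module Defs where

open import Level using (0ℓ)
open import Algebra.Bundles using (CommutativeRing)
open import Data.Bool.Base using (Bool; T)
open import Data.Fin.Base using (Fin; inject₁; fromℕ)
open import Data.List.Base using (List; length)
open import Data.List.Relation.Unary.Any using (Any)
open import Data.List.Relation.Unary.Unique.Propositional using (Unique)
open import Data.Nat.Base as ℕ using (ℕ; suc)
open import Data.Product.Base using (∃; _×_)
open import Relation.Binary.Core using (Rel)
open import Relation.Binary.Structures using (IsTotalOrder)
open import Relation.Binary.Construct.Closure.Equivalence using (EqClosure)
open import Relation.Binary.Construct.Closure.ReflexiveTransitive using (Star; ε; _◅_)
open import Relation.Binary.Construct.Closure.Transitive using (TransClosure)
open import Relation.Nullary.Negation.Core using (¬_)
open import Relation.Unary using (Pred)
import Algebra.Properties.Monoid.Sum as Sum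

-- The standard library has no real numbers.  They are given here by their
-- usual axioms: a totally ordered field in which every inhabited subset that
-- is bounded above has a least upper bound.  Such a field is unique up to
-- isomorphism, in classical logic.

record RealNumbers : Set₁ where
  field
    commutativeRing : CommutativeRing 0ℓ 0ℓ

  open CommutativeRing commutativeRing public

  infix 4 _≤_

  field
    0≉1          : ¬ (0# ≈ 1#)
    inverse      : ∀ x → ¬ (x ≈ 0#) → ∃ λ y → x * y ≈ 1#
    _≤_          : Rel Carrier 0ℓ
    isTotalOrder : IsTotalOrder _≈_ _≤_
    +-monoˡ-≤    : ∀ z {x y} → x ≤ y → x + z ≤ y + z
    *-nonNeg     : ∀ {x y} → 0# ≤ x → 0# ≤ y → 0# ≤ x * y

  UpperBound : Pred Carrier 0ℓ → Pred Carrier 0ℓ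
  UpperBound A b = ∀ x → A x → x ≤ b

  field
    supremum : (A : Pred Carrier 0ℓ) → ∃ A → ∃ (UpperBound A) →
               ∃ λ s → UpperBound A s × (∀ b → UpperBound A b → s ≤ b)

module _ (ℝ : RealNumbers) where

  open RealNumbers ℝ using (Carrier; _+_; _*_; 0#; _≤_; +-monoid)
  open Sum +-monoid using (sum-syntax)

  -- Edges are a Boolean relation, so there are no parallel edges; `acyclic`
  -- rules out loops and antiparallel pairs.  Connectedness is that of the
  -- underlying undirected graph.

  record ParametricDAG (n d : ℕ) : Set where
    field
      edge? : Fin n → Fin n → Bool

    Edge : Rel (Fin n) 0ℓ
    Edge u v = T (edge? u v)

    field
      acyclic   : ∀ v → ¬ TransClosure Edge v v
      connected : ∀ u v → EqClosure Edge u v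
      coeff     : ∀ {u v} → Edge u v → Fin (suc d) → Carrier
      s t       : Fin n
      s-t-path  : Star Edge s t

  module _ {n d : ℕ} (G : ParametricDAG n d) where

    open ParametricDAG G

    -- By acyclicity a directed walk never repeats a vertex.
    Path : Rel (Fin n) 0ℓ
    Path = Star Edge

    -- The last coefficient is the constant term.
    edgeWeight : ∀ {u v} → Edge u v → (Fin d → Carrier) → Carrier
    edgeWeight e x = (∑[ i < d ] (coeff e (inject₁ i) * x i)) + coeff e (fromℕ d)

    weight : ∀ {u v} → Path u v → (Fin d → Carrier) → Carrier
    weight ε       x = 0#
    weight (e ◅ P) x = edgeWeight e x + weight P x

    IsShortestAt : (Fin d → Carrier) → Pred (Path s t) 0ℓ
    IsShortestAt x P = ∀ (Q : Path s t) → weight P x ≤ weight Q x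

    -- Since there are finitely many s-t paths, their subsets are the
    -- duplicate-free lists, with `length` as cardinality.
    record IsShortestPathCover (S : List (Path s t)) : Set where
      field
        unique : Unique S
        covers : ∀ (x : Fin d → Carrier) → Any (IsShortestAt x) S

    record IsMSPC (S : List (Path s t)) : Set where
      field
        isCover : IsShortestPathCover S
        minimum : ∀ S′ → IsShortestPathCover S′ → length S ℕ.≤ length S′

-- k ≤ n ^[ m ·log₂] says k ≤ n ^ (m · log₂ n), for n ≥ 1, with the exact real-valued logarithm and
-- power: n ^ (m · log₂ n) is the infimum of n ^ (m · p / q) over all fractions
-- p / q ≥ log₂ n; clearing denominators, p / q ≥ log₂ n becomes n ^ q ≤ 2 ^ p,
-- and k ≤ n ^ (m · p / q) becomes k ^ q ≤ n ^ (m · p).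

infix 4 _≤_^[_·log₂]

_≤_^[_·log₂] : ℕ → ℕ → ℕ → Set
k ≤ n ^[ m ·log₂] =
  ∀ p q → 0 ℕ.< q → n ℕ.^ q ℕ.≤ 2 ℕ.^ p → k ℕ.^ q ℕ.≤ n ℕ.^ (m ℕ.* p)

{-# OPTIONS --safe #-}

-- Shortest paths are computed by repeated squaring.  Once the cheapest walks on at most k edges are known
-- for all pairs of vertices, finding those on at most 2k edges means comparing, for every pair u, v and
-- all midpoints w, w′, the sums through w and w′: at most n⁴ comparisons of linear forms in d + 1
-- homogeneous variables.  The signs of these forms take at most (n⁴ + 1)^(d + 1) patterns, and a pattern
-- determines the outcome of the squaring.  About log n squarings suffice, since walks in a DAG have fewer
-- than n edges, so all shortest s-t paths are found among (n⁴ + 1)^(O(d log n)) candidates.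

module Submission where

open import Defs
open import Level using (0ℓ)
open import Axiom.ExcludedMiddle using (ExcludedMiddle)
open import Data.Bool.Properties using (T?; T-irrelevant)
open import Data.Empty using (⊥-elim)
open import Data.Fin.Base as Fin using (Fin; zero; suc; inject₁; fromℕ)
open import Data.Fin.Properties as Fin using (pigeonhole)
open import Data.List.Base
  using (List; []; _∷_; _++_; length; map; concatMap; mapMaybe; cartesianProductWith; allFin; deduplicate)
import Data.List.Extrema as Extrema
open import Data.List.Membership.Propositional using (_∈_; find; lose)
open import Data.List.Membership.Propositional.Properties
  using (∈-allFin; ∈-concatMap⁺; ∈-cartesianProductWith⁺; ∈-deduplicate⁺)
open import Data.List.Properties
  using (length-++; length-map; length-mapMaybe; length-tabulate; length-deduplicate)
open import Data.List.Relation.Unary.All as All using (All; []; _∷_)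
import Data.List.Relation.Unary.All.Properties as All
open import Data.List.Relation.Unary.Any as Any using (Any; here; there)
import Data.List.Relation.Unary.Any.Properties as Any
open import Data.List.Relation.Unary.Unique.DecPropositional.Properties using (deduplicate-!)
open import Data.Maybe.Base as Maybe using (Maybe; just; nothing)
open import Data.Maybe.Properties using (just-injective)
import Data.Maybe.Relation.Unary.Any as MaybeAny
open import Data.Nat.Base as ℕ using (ℕ; zero; suc; _*_; _<_; _≤_; _^_; s≤s; z≤n)
import Data.Nat.Properties as ℕ
open import Data.Nat.Solver using (module +-*-Solver)
open import Data.Product.Base using (∃; ∃-syntax; ∃₂; _×_; _,_; proj₁; proj₂)
open import Data.Sum.Base using (inj₁; inj₂)
open import Data.Vec.Functional using (removeAt)
open import Function.Base using (_∘_)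
open import Function.Bundles using (_⇔_; mk⇔; module Equivalence)
open import Function.Construct.Composition using (_⇔-∘_)
open import Function.Construct.Identity using (⇔-id)
open import Function.Construct.Symmetry using (⇔-sym)
open import Relation.Binary.Bundles using (TotalOrder)
open import Relation.Binary.Construct.Closure.ReflexiveTransitive using (ε; _◅_; _◅◅_)
open import Relation.Binary.Construct.Closure.Transitive using (TransClosure; [_]; _∷_)
open import Relation.Binary.Definitions using (DecidableEquality)
open import Relation.Binary.PropositionalEquality as ≡ using (_≡_)
open import Relation.Binary.Structures using (IsTotalOrder)
open import Relation.Nullary using (¬_; yes; no)
open import Relation.Nullary.Decidable using (decidable-stable)
import Algebra.Properties.CommutativeMonoid.Sum as CommutativeMonoidSum
import Algebra.Properties.Monoid.Sum as MonoidSum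
import Algebra.Properties.Ring as RingProperties
import Algebra.Properties.Semiring.Sum as SemiringSum
import Relation.Binary.Reasoning.Setoid as SetoidReasoning

open +-*-Solver using (solve; _:+_; _:*_; _:=_; con)

-- This is the recurrence for the number of cells: one more form adds at most as many cells as its
-- hyperplane has, in one dimension less.
m^1+n+m^n≤[1+m]^1+n : ∀ m n → m ^ suc n ℕ.+ m ^ n ≤ suc m ^ suc n
m^1+n+m^n≤[1+m]^1+n m n = begin
  m ^ suc n ℕ.+ m ^ n  ≡⟨ ℕ.+-comm (m ^ suc n) (m ^ n) ⟩
  suc m * m ^ n        ≤⟨ ℕ.*-monoʳ-≤ (suc m) (ℕ.^-monoˡ-≤ n (ℕ.n≤1+n m)) ⟩
  suc m ^ suc n        ∎
  where open ℕ.≤-Reasoning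

-- Linear forms over an ordered field and their signs.

module LinearForms (ℝ : RealNumbers) where

  open RealNumbers ℝ renaming (_*_ to _·_; _≤_ to _⊑_; _-_ to _⊖_)
  open IsTotalOrder isTotalOrder
    using ()
    renaming (reflexive to ⊑-reflexive; trans to ⊑-trans; antisym to ⊑-antisym; total to ⊑-total;
              ≲-respˡ-≈ to ⊑-respˡ-≈; ≲-respʳ-≈ to ⊑-respʳ-≈)
  open RingProperties ring using (-‿distribˡ-*; -‿distribʳ-*)
  open MonoidSum +-monoid using (sum; sum-cong-≋; sum-replicate-zero)
  open CommutativeMonoidSum +-commutativeMonoid using (∑-distrib-+; sum-remove)
  open SemiringSum semiring using (*-distribˡ-sum)
  open SetoidReasoning setoid

  Point : ℕ → Set
  Point D = Fin D → Carrier

  ⟨_,_⟩ : ∀ {D} → Point D → Point D → Carrier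
  ⟨ g , x ⟩ = sum (λ i → g i · x i)

  ⟨⟩-comm : ∀ {D} (g x : Point D) → ⟨ g , x ⟩ ≈ ⟨ x , g ⟩
  ⟨⟩-comm g x = sum-cong-≋ (λ i → *-comm (g i) (x i))

  ⟨⟩-zeroˡ : ∀ {D} (g x : Point D) → (∀ i → g i ≈ 0#) → ⟨ g , x ⟩ ≈ 0#
  ⟨⟩-zeroˡ {D} g x g≈0 =
    trans (sum-cong-≋ (λ i → trans (*-congʳ (g≈0 i)) (zeroˡ (x i)))) (sum-replicate-zero D)

  ⟨⟩-+ˡ : ∀ {D} (g h x : Point D) → ⟨ (λ i → g i + h i) , x ⟩ ≈ ⟨ g , x ⟩ + ⟨ h , x ⟩
  ⟨⟩-+ˡ g h x = trans (sum-cong-≋ (λ i → distribʳ (x i) (g i) (h i)))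
                      (∑-distrib-+ (λ i → g i · x i) (λ i → h i · x i))

  ⟨⟩-*ˡ : ∀ {D} k (g x : Point D) → ⟨ (λ i → k · g i) , x ⟩ ≈ k · ⟨ g , x ⟩
  ⟨⟩-*ˡ k g x = trans (sum-cong-≋ (λ i → *-assoc k (g i) (x i)))
                      (sym (*-distribˡ-sum k (λ i → g i · x i)))

  ⟨⟩-linˡ : ∀ {D} k (g h x : Point D) →
            ⟨ (λ i → g i + k · h i) , x ⟩ ≈ ⟨ g , x ⟩ + k · ⟨ h , x ⟩
  ⟨⟩-linˡ k g h x = trans (⟨⟩-+ˡ g (λ i → k · h i) x) (+-congˡ (⟨⟩-*ˡ k h x))

  ⟨⟩-bilinʳ : ∀ {D} a b (g x y : Point D) →
              ⟨ g , (λ i → a · x i + b · y i) ⟩ ≈ a · ⟨ g , x ⟩ + b · ⟨ g , y ⟩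
  ⟨⟩-bilinʳ a b g x y = begin
    ⟨ g , (λ i → a · x i + b · y i) ⟩                 ≈⟨ ⟨⟩-comm g _ ⟩
    ⟨ (λ i → a · x i + b · y i) , g ⟩                 ≈⟨ ⟨⟩-linˡ b (λ i → a · x i) y g ⟩
    ⟨ (λ i → a · x i) , g ⟩ + b · ⟨ y , g ⟩           ≈⟨ +-cong (trans (⟨⟩-*ˡ a x g) (*-congˡ (⟨⟩-comm x g)))
                                                               (*-congˡ (⟨⟩-comm y g)) ⟩
    a · ⟨ g , x ⟩ + b · ⟨ g , y ⟩                     ∎

  ⊑0⇒0⊑- : ∀ {a} → a ⊑ 0# → 0# ⊑ - a
  ⊑0⇒0⊑- {a} a≤0 = ⊑-respˡ-≈ (-‿inverseʳ a) (⊑-respʳ-≈ (+-identityˡ (- a)) (+-monoˡ-≤ (- a) a≤0))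

  0⊑-⇒⊑0 : ∀ {a} → 0# ⊑ - a → a ⊑ 0#
  0⊑-⇒⊑0 {a} 0≤-a = ⊑-respˡ-≈ (+-identityˡ a) (⊑-respʳ-≈ (-‿inverseˡ a) (+-monoˡ-≤ a 0≤-a))

  ≰0⇒0⊑ : ∀ {a} → ¬ (a ⊑ 0#) → 0# ⊑ a
  ≰0⇒0⊑ {a} a≰0 with ⊑-total a 0#
  ... | inj₁ a≤0 = ⊥-elim (a≰0 a≤0)
  ... | inj₂ 0≤a = 0≤a

  +-monoʳ-⊑ : ∀ z {x y} → x ⊑ y → z + x ⊑ z + y
  +-monoʳ-⊑ z {x} {y} p = ⊑-respˡ-≈ (+-comm x z) (⊑-respʳ-≈ (+-comm y z) (+-monoˡ-≤ z p))

  +-mono-⊑ : ∀ {a b c d} → a ⊑ b → c ⊑ d → a + c ⊑ b + d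
  +-mono-⊑ {b = b} {c} p q = ⊑-trans (+-monoˡ-≤ c p) (+-monoʳ-⊑ b q)

  x⊑y⇒x-y⊑0 : ∀ {x y} → x ⊑ y → x ⊖ y ⊑ 0#
  x⊑y⇒x-y⊑0 {x} {y} p = ⊑-respʳ-≈ (-‿inverseʳ y) (+-monoˡ-≤ (- y) p)

  x-y⊑0⇒x⊑y : ∀ {x y} → x ⊖ y ⊑ 0# → x ⊑ y
  x-y⊑0⇒x⊑y {x} {y} p =
    ⊑-respˡ-≈ (trans (+-assoc x (- y) y) (trans (+-congˡ (-‿inverseˡ y)) (+-identityʳ x)))
      (⊑-respʳ-≈ (+-identityˡ y) (+-monoˡ-≤ y p))

  *-nonNeg-nonPos : ∀ {a b} → 0# ⊑ a → b ⊑ 0# → a · b ⊑ 0#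
  *-nonNeg-nonPos {a} {b} 0≤a b≤0 =
    0⊑-⇒⊑0 (⊑-respʳ-≈ (sym (-‿distribʳ-* a b)) (*-nonNeg 0≤a (⊑0⇒0⊑- b≤0)))

  -- The product is also nonnegative, hence zero, and `a` is invertible.
  *-cancelˡ-⊑0 : ∀ {a b} → ¬ (a ⊑ 0#) → 0# ⊑ b → a · b ⊑ 0# → b ⊑ 0#
  *-cancelˡ-⊑0 {a} {b} a≰0 0≤b ab≤0 with a⁻¹ , aa⁻¹≈1 ← inverse a (a≰0 ∘ ⊑-reflexive) =
    ⊑-reflexive (begin
      b             ≈⟨ *-identityˡ b ⟨
      1# · b        ≈⟨ *-congʳ (trans (*-comm a⁻¹ a) aa⁻¹≈1) ⟨
      (a⁻¹ · a) · b ≈⟨ *-assoc a⁻¹ a b ⟩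
      a⁻¹ · (a · b) ≈⟨ *-congˡ (⊑-antisym ab≤0 (*-nonNeg (≰0⇒0⊑ a≰0) 0≤b)) ⟩
      a⁻¹ · 0#      ≈⟨ zeroʳ a⁻¹ ⟩
      0#            ∎)

  infix 4 _∼[_]_

  -- The classes are the cells of an arrangement of half-spaces. Only nonpositive and positive
  -- values are told apart, as one comparison of two costs yields no more.
  record _∼[_]_ {D} (x : Point D) (F : List (Point D)) (y : Point D) : Set where
    constructor signs
    field sameSign : All (λ g → ⟨ g , x ⟩ ⊑ 0# ⇔ ⟨ g , y ⟩ ⊑ 0#) F

  ∼-sym : ∀ {D} {F : List (Point D)} {x y} → x ∼[ F ] y → y ∼[ F ] x
  ∼-sym (signs p) = signs (All.map ⇔-sym p)

  ∼-trans : ∀ {D} {F : List (Point D)} {x y z} → x ∼[ F ] y → y ∼[ F ] z → x ∼[ F ] z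
  ∼-trans (signs p) (signs q) = signs (All.zipWith (λ (a , b) → b ⇔-∘ a) (p , q))

  ∼-∷ : ∀ {D} {h : Point D} {F x y} →
        (⟨ h , x ⟩ ⊑ 0# ⇔ ⟨ h , y ⟩ ⊑ 0#) → x ∼[ F ] y → x ∼[ h ∷ F ] y
  ∼-∷ p (signs q) = signs (p ∷ q)

  -- Cells are convex cones. One coefficient has to be strictly positive, because at the origin
  -- every form is nonpositive.
  cone-∼ : ∀ {D} {F : List (Point D)} {a b} → ¬ (a ⊑ 0#) → 0# ⊑ b → ∀ {x y} →
           x ∼[ F ] y → x ∼[ F ] (λ i → a · x i + b · y i)
  cone-∼ {a = a} {b} a≰0 0≤b {x} {y} (signs p) = signs (All.map (λ {g} x∼y → mk⇔
    (λ gx≤0 → ⊑-respˡ-≈ (sym (⟨⟩-bilinʳ a b g x y)) (⊑-respʳ-≈ (+-identityˡ 0#)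
                (+-mono-⊑ (*-nonNeg-nonPos (≰0⇒0⊑ a≰0) gx≤0)
                          (*-nonNeg-nonPos 0≤b (Equivalence.to x∼y gx≤0)))))
    (λ gz≤0 → gx≤0 g x∼y (⊑-respˡ-≈ (⟨⟩-bilinʳ a b g x y) gz≤0))) p)
    where
    gx≤0 : ∀ g → (⟨ g , x ⟩ ⊑ 0# ⇔ ⟨ g , y ⟩ ⊑ 0#) → a · ⟨ g , x ⟩ + b · ⟨ g , y ⟩ ⊑ 0# → ⟨ g , x ⟩ ⊑ 0#
    gx≤0 g x∼y p with ⊑-total ⟨ g , x ⟩ 0# | ⊑-total ⟨ g , y ⟩ 0#
    ... | inj₁ q | _      = q
    ... | inj₂ _ | inj₁ q = Equivalence.from x∼y q
    -- Here `b · ⟨ g , y ⟩` is nonnegative, and dropping it leaves `a · ⟨ g , x ⟩ ⊑ 0#`.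
    ... | inj₂ q | inj₂ r = *-cancelˡ-⊑0 a≰0 q
      (⊑-trans (⊑-respˡ-≈ (+-identityʳ _) (+-monoʳ-⊑ _ (*-nonNeg 0≤b r))) p)

  module Elimination {D} (h : Point (suc D)) (j : Fin (suc D)) (hⱼ≉0 : ¬ (h j ≈ 0#)) where

    private
      hⱼ⁻¹ : Carrier
      hⱼ⁻¹ = proj₁ (inverse (h j) hⱼ≉0)

    -- Subtracting a multiple of `h` clears coefficient `j` and changes no value on the hyperplane
    -- `h = 0`, so this is the restriction of `g` to that hyperplane, with coordinate `j` dropped.
    eliminate : Point (suc D) → Point D
    eliminate g = removeAt (λ i → g i + - (g j · hⱼ⁻¹) · h i) j

    eliminate-⟨⟩ : ∀ g x → ⟨ h , x ⟩ ≈ 0# → ⟨ eliminate g , removeAt x j ⟩ ≈ ⟨ g , x ⟩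
    eliminate-⟨⟩ g x hx≈0 = begin
      ⟨ eliminate g , removeAt x j ⟩                   ≈⟨ +-identityˡ _ ⟨
      0# + ⟨ eliminate g , removeAt x j ⟩              ≈⟨ +-congʳ (trans (*-congʳ ĝⱼ≈0) (zeroˡ (x j))) ⟨
      ĝ j · x j + ⟨ eliminate g , removeAt x j ⟩       ≈⟨ sum-remove {i = j} (λ i → ĝ i · x i) ⟨
      ⟨ ĝ , x ⟩                                        ≈⟨ ⟨⟩-linˡ k g h x ⟩
      ⟨ g , x ⟩ + k · ⟨ h , x ⟩                        ≈⟨ +-congˡ (trans (*-congˡ hx≈0) (zeroʳ k)) ⟩
      ⟨ g , x ⟩ + 0#                                   ≈⟨ +-identityʳ _ ⟩
      ⟨ g , x ⟩                                        ∎
      where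
      k : Carrier
      k = - (g j · hⱼ⁻¹)

      ĝ : Point (suc D)
      ĝ i = g i + k · h i

      ĝⱼ≈0 : ĝ j ≈ 0#
      ĝⱼ≈0 = begin
        g j + - (g j · hⱼ⁻¹) · h j   ≈⟨ +-congˡ (-‿distribˡ-* _ _) ⟨
        g j + - ((g j · hⱼ⁻¹) · h j) ≈⟨ +-congˡ (-‿cong (*-assoc _ _ _)) ⟩
        g j + - (g j · (hⱼ⁻¹ · h j)) ≈⟨ +-congˡ (-‿cong (*-congˡ
                                          (trans (*-comm hⱼ⁻¹ (h j)) (proj₂ (inverse (h j) hⱼ≉0))))) ⟩
        g j + - (g j · 1#)           ≈⟨ +-congˡ (-‿cong (*-identityʳ (g j))) ⟩
        g j + - g j                  ≈⟨ -‿inverseʳ (g j) ⟩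
        0#                           ∎

  -- Counting the cells of an arrangement.

  module Arrangement (em : ExcludedMiddle 0ℓ) where

    Representatives : ∀ {D} → List (Point D) → List (Point D) → Set
    Representatives F Y = ∀ x → Any (λ y → x ∼[ F ] y) Y

    -- The default `y` matters: a representative is kept when no point with the wanted property
    -- exists.
    choose : ∀ {D} → (Point D → Set) → Point D → Point D
    choose P y with em {∃ P}
    ... | yes (x , _) = x
    ... | no _        = y

    choose-sat : ∀ {D} (P : Point D → Set) x y → P x → P (choose P y)
    choose-sat P x y Px with em {∃ P}
    ... | yes (_ , Px′) = Px′
    ... | no ∄x         = ⊥-elim (∄x (_ , Px))

    -- A cell of F that h cuts contains a point of the hyperplane h = 0, so the cells of h ∷ F are at
    -- most the cells of F together with those of the restriction of F to this hyperplane.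
    cutRepresentatives : ∀ {D} (h : Point (suc D)) (F : List (Point (suc D))) (j : Fin (suc D))
      (hⱼ≉0 : ¬ (h j ≈ 0#)) {Y Z} → Representatives F Y →
      Representatives (map (Elimination.eliminate h j hⱼ≉0) F) Z →
      ∃[ W ] (length W ≡ length Y ℕ.+ length Z × Representatives (h ∷ F) W)
    cutRepresentatives h F j hⱼ≉0 {Y} {Z} repY repZ = W , W-length , repW
      where
      open Elimination h j hⱼ≉0

      Below : Point _ → Point _ → Set
      Below y x = ⟨ h , x ⟩ ⊑ 0# × x ∼[ F ] y

      Above : Point _ → Point _ → Set
      Above z x = ¬ (⟨ h , x ⟩ ⊑ 0#) × All (λ g → ⟨ g , x ⟩ ⊑ 0# ⇔ ⟨ eliminate g , z ⟩ ⊑ 0#) F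

      -- `below y` is a point with `h ≤ 0` in the cell of `y` if there is one, and otherwise `y`
      -- itself. `above z` is a point with `h > 0` in the cell of `F` that `z` represents on the
      -- hyperplane; its default `0#` is a mere placeholder.
      below above : Point _ → Point _
      below y = choose (Below y) y
      above z = choose (Above z) (λ _ → 0#)

      W : List (Point _)
      W = map below Y ++ map above Z

      W-length : length W ≡ length Y ℕ.+ length Z
      W-length = ≡.trans (length-++ (map below Y)) (≡.cong₂ ℕ._+_ (length-map below Y) (length-map above Z))

      repW : Representatives (h ∷ F) W
      repW x with em {⟨ h , x ⟩ ⊑ 0#}
      ... | yes hx≤0 = Any.++⁺ˡ (Any.map⁺ (Any.map (λ {y} x∼y →
              let hy≤0 , y∼ = choose-sat (Below y) x y (hx≤0 , x∼y)
              in ∼-∷ (mk⇔ (λ _ → hy≤0) (λ _ → hx≤0)) (∼-trans x∼y (∼-sym y∼))) (repY x)))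
      ... | no hx≰0 with em {∃ λ y → ⟨ h , y ⟩ ⊑ 0# × x ∼[ F ] y}
      ...   | yes (y , hy≤0 , x∼y) = Any.++⁺ʳ (map below Y) (Any.map⁺ (Any.map (λ {z} v∼z →
              let hx≰0′ , ∼z = choose-sat (Above z) x (λ _ → 0#) (hx≰0 , x∼elim v∼z)
              in ∼-∷ (mk⇔ (⊥-elim ∘ hx≰0) (⊥-elim ∘ hx≰0′))
                   (signs (All.zipWith (λ (p , q) → ⇔-sym q ⇔-∘ p) (x∼elim v∼z , ∼z))))
              (repZ (removeAt v j))))
        where
        -- Up to a positive factor, `v` is the point where the segment from `x` to `y` meets
        -- `h = 0`: the coefficients are positive and nonnegative, so `v` stays in the cell.
        v : Point _
        v i = ⟨ h , x ⟩ · y i + - ⟨ h , y ⟩ · x i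

        hv≈0 : ⟨ h , v ⟩ ≈ 0#
        hv≈0 = begin
          ⟨ h , v ⟩                                         ≈⟨ ⟨⟩-bilinʳ _ _ h y x ⟩
          ⟨ h , x ⟩ · ⟨ h , y ⟩ + - ⟨ h , y ⟩ · ⟨ h , x ⟩   ≈⟨ +-cong (*-comm _ _) (sym (-‿distribˡ-* _ _)) ⟩
          ⟨ h , y ⟩ · ⟨ h , x ⟩ + - (⟨ h , y ⟩ · ⟨ h , x ⟩) ≈⟨ -‿inverseʳ _ ⟩
          0#                                                ∎

        x∼v : x ∼[ F ] v
        x∼v = ∼-trans x∼y (cone-∼ hx≰0 (⊑0⇒0⊑- hy≤0) (∼-sym x∼y))

        x∼elim : ∀ {z} → removeAt v j ∼[ map eliminate F ] z →
                 All (λ g → ⟨ g , x ⟩ ⊑ 0# ⇔ ⟨ eliminate g , z ⟩ ⊑ 0#) F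
        x∼elim (signs p) = All.zipWith (λ {g} (p , q) → q ⇔-∘ (elim g ⇔-∘ p))
                                       (_∼[_]_.sameSign x∼v , All.map⁻ p)
          where
          elim : ∀ g → ⟨ g , v ⟩ ⊑ 0# ⇔ ⟨ eliminate g , removeAt v j ⟩ ⊑ 0#
          elim g = mk⇔ (⊑-respˡ-≈ (sym (eliminate-⟨⟩ g v hv≈0))) (⊑-respˡ-≈ (eliminate-⟨⟩ g v hv≈0))
      -- Now `h` is positive on the whole cell of `x`, so `below` falls back on its default there
      -- and keeps the representative.
      ...   | no ∄y = Any.++⁺ˡ (Any.map⁺ (Any.map (λ {y} x∼y →
              let y∼x , hb≰0 = below-spec y x∼y
              in ∼-∷ (mk⇔ (⊥-elim ∘ hx≰0) (⊥-elim ∘ hb≰0)) y∼x) (repY x)))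
        where
        below-spec : ∀ y → x ∼[ F ] y → x ∼[ F ] below y × ¬ (⟨ h , below y ⟩ ⊑ 0#)
        below-spec y x∼y with em {∃ (Below y)}
        ... | yes (y′ , hy′≤0 , y′∼y) = ⊥-elim (∄y (y′ , hy′≤0 , ∼-trans x∼y (∼-sym y′∼y)))
        ... | no _                    = x∼y , λ hy≤0 → ∄y (y , hy≤0 , x∼y)

    -- Induction on the dimension and the number of forms: the cells of `F` are counted in the same
    -- dimension, those of its restriction to `h = 0` in one dimension less.
    representatives : ∀ {D} (F : List (Point D)) →
      ∃[ Y ] (length Y ≤ suc (length F) ^ D × Representatives F Y)
    -- In dimension zero every form is the empty sum at every point.
    representatives {zero} F = (λ ()) ∷ [] , ℕ.≤-refl , λ x → here (signs (All.universal (λ g → ⇔-id _) F))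
    representatives {suc D} [] = (λ _ → 0#) ∷ [] , ℕ.m^n>0 1 (suc D) , λ x → here (signs [])
    representatives {suc D} (h ∷ F) with em {∃ λ j → ¬ (h j ≈ 0#)} | representatives F
    -- The form `h` is zero and cuts no cell.
    ... | no ∄j | Y , Y-length , repY =
      Y , ℕ.≤-trans Y-length (ℕ.^-monoˡ-≤ (suc D) (ℕ.n≤1+n _)) ,
      λ x → Any.map (λ {y} x∼y → ∼-∷ (mk⇔ (λ _ → h≤0 y) (λ _ → h≤0 x)) x∼y) (repY x)
      where
      h≤0 : ∀ x → ⟨ h , x ⟩ ⊑ 0#
      h≤0 x = ⊑-reflexive (⟨⟩-zeroˡ h x (λ j → decidable-stable em (λ hⱼ≉0 → ∄j (j , hⱼ≉0))))
    ... | yes (j , hⱼ≉0) | Y , Y-length , repY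
      with Z , Z-length , repZ ← representatives (map (Elimination.eliminate h j hⱼ≉0) F)
      with W , W-length , repW ← cutRepresentatives h F j hⱼ≉0 repY repZ =
      W ,
      ℕ.≤-trans (ℕ.≤-reflexive W-length) (ℕ.≤-trans
        (ℕ.+-mono-≤ Y-length (≡.subst (λ l → length Z ≤ suc l ^ D) (length-map _ F) Z-length))
        (m^1+n+m^n≤[1+m]^1+n (suc (length F)) D)) ,
      repW

-- Lengths of concatenations and products.

length-concatMap : ∀ {A B : Set} {f : A → List B} {m} → (∀ a → length (f a) ≤ m) →
                   ∀ xs → length (concatMap f xs) ≤ length xs * m
length-concatMap f≤m [] = z≤n
length-concatMap {f = f} f≤m (x ∷ xs) = ℕ.≤-trans (ℕ.≤-reflexive (length-++ (f x)))
  (ℕ.+-mono-≤ (f≤m x) (length-concatMap f≤m xs))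

length-cartesianProductWith : ∀ {A B C : Set} (f : A → B → C) xs ys →
                              length (cartesianProductWith f xs ys) ≡ length xs * length ys
length-cartesianProductWith f []       ys = ≡.refl
length-cartesianProductWith f (x ∷ xs) ys = ≡.trans (length-++ (map (f x) ys))
  (≡.cong₂ ℕ._+_ (length-map (f x) ys) (length-cartesianProductWith f xs ys))

-- Walks in the DAG and their lengths.

module ShortestPaths (em : ExcludedMiddle 0ℓ) (ℝ : RealNumbers) {n d : ℕ} (G : ParametricDAG ℝ n d) where

  open RealNumbers ℝ hiding (zero) renaming (_*_ to _·_; _≤_ to _⊑_)
  open IsTotalOrder isTotalOrder
    using ()
    renaming (trans to ⊑-trans; reflexive to ⊑-reflexive; ≲-respˡ-≈ to ⊑-respˡ-≈; ≲-respʳ-≈ to ⊑-respʳ-≈)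
  open LinearForms ℝ
  open Arrangement em
  open ParametricDAG G

  ⊑-totalOrder : TotalOrder 0ℓ 0ℓ 0ℓ
  ⊑-totalOrder = record { isTotalOrder = isTotalOrder }

  open Extrema ⊑-totalOrder using (argmin; argmin-sel; f[argmin]≤f[⊤]; f[argmin]≤f[xs])
  open MonoidSum +-monoid using (sum)
  open RingProperties ring using (-1*x≈-x)
  open SetoidReasoning setoid

  Walk : Fin n → Fin n → Set
  Walk = Path ℝ G

  ∣_∣ : ∀ {u v} → Walk u v → ℕ
  ∣ ε ∣     = 0
  ∣ e ◅ P ∣ = suc ∣ P ∣

  vertex : ∀ {u v} (P : Walk u v) → Fin (suc ∣ P ∣) → Fin n
  vertex {u} P       zero    = u
  vertex     (e ◅ P) (suc i) = vertex P i

  vertex-reachable : ∀ {u v w} (e : Edge u v) (P : Walk v w) i → TransClosure Edge u (vertex P i)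
  vertex-reachable e P       zero    = [ e ]
  vertex-reachable e (f ◅ P) (suc i) = e ∷ vertex-reachable f P i

  vertex-< : ∀ {u v} (P : Walk u v) {i j} → i Fin.< j → TransClosure Edge (vertex P i) (vertex P j)
  vertex-< (e ◅ P) {zero}  {suc j} _       = vertex-reachable e P j
  vertex-< (e ◅ P) {suc i} {suc j} (s≤s p) = vertex-< P p

  -- Otherwise the walk visits more than `n` vertices, one of them twice, and the stretch between
  -- the two visits is a directed cycle.
  ∣P∣<n : ∀ {u v} (P : Walk u v) → ∣ P ∣ < n
  ∣P∣<n P = ℕ.≰⇒> λ n≤∣P∣ →
    let i , j , i<j , Pᵢ≡Pⱼ = pigeonhole (s≤s n≤∣P∣) (vertex P)
    in acyclic _ (≡.subst (TransClosure Edge _) (≡.sym Pᵢ≡Pⱼ) (vertex-< P i<j))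

  -- The cut is made after `a` edges, or at the end of a walk shorter than that.
  split : ∀ a {b u v} (P : Walk u v) → ∣ P ∣ ≤ a ℕ.+ b →
          ∃[ w ] ∃₂ λ (P₁ : Walk u w) (P₂ : Walk w v) → P₁ ◅◅ P₂ ≡ P × ∣ P₁ ∣ ≤ a × ∣ P₂ ∣ ≤ b
  split zero    P       p       = _ , ε , P , ≡.refl , z≤n , p
  split (suc a) ε       p       = _ , ε , ε , ≡.refl , z≤n , z≤n
  split (suc a) (e ◅ P) (s≤s p) with w , P₁ , P₂ , eq , p₁ , p₂ ← split a P p =
    w , e ◅ P₁ , P₂ , ≡.cong (e ◅_) eq , s≤s p₁ , p₂

  -- Costs of walks as linear forms.

  coefficients : ∀ {u v} → Walk u v → Point (suc d)
  coefficients ε         = λ _ → 0#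
  coefficients (e ◅ P) i = coeff e i + coefficients P i

  cost : ∀ {u v} → Walk u v → Point (suc d) → Carrier
  cost P y = ⟨ coefficients P , y ⟩

  cost-◅◅ : ∀ {u v w} (P : Walk u v) (Q : Walk v w) y → cost (P ◅◅ Q) y ≈ cost P y + cost Q y
  cost-◅◅ ε       Q y = sym (trans (+-congʳ (⟨⟩-zeroˡ (λ _ → 0#) y (λ _ → refl))) (+-identityˡ (cost Q y)))
  cost-◅◅ (e ◅ P) Q y = begin
    cost (e ◅ (P ◅◅ Q)) y                  ≈⟨ ⟨⟩-+ˡ (coeff e) (coefficients (P ◅◅ Q)) y ⟩
    ⟨ coeff e , y ⟩ + cost (P ◅◅ Q) y      ≈⟨ +-congˡ (cost-◅◅ P Q y) ⟩
    ⟨ coeff e , y ⟩ + (cost P y + cost Q y) ≈⟨ +-assoc _ _ _ ⟨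
    (⟨ coeff e , y ⟩ + cost P y) + cost Q y ≈⟨ +-congʳ (⟨⟩-+ˡ (coeff e) (coefficients P) y) ⟨
    cost (e ◅ P) y + cost Q y              ∎

  -- The coordinate 1 is appended last, facing the constant term, so that affine weights become
  -- linear forms in one more variable.
  homogenise : ∀ {m} → Point m → Point (suc m)
  homogenise {zero}  x _       = 1#
  homogenise {suc m} x zero    = x zero
  homogenise {suc m} x (suc i) = homogenise (x ∘ suc) i

  ⟨⟩-homogenise : ∀ {m} (g : Point (suc m)) (x : Point m) →
                  sum (λ i → g (inject₁ i) · x i) + g (fromℕ m) ≈ ⟨ g , homogenise x ⟩
  ⟨⟩-homogenise {zero}  g x = trans (+-comm _ _) (+-congʳ (sym (*-identityʳ (g zero))))
  ⟨⟩-homogenise {suc m} g x = trans (+-assoc _ _ _) (+-congˡ (⟨⟩-homogenise (g ∘ suc) (x ∘ suc)))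

  weight≈cost : ∀ {u v} (P : Walk u v) x → weight ℝ G P x ≈ cost P (homogenise x)
  weight≈cost ε       x = sym (⟨⟩-zeroˡ (λ _ → 0#) (homogenise x) (λ _ → refl))
  weight≈cost (e ◅ P) x = trans (+-cong (⟨⟩-homogenise (coeff e) x) (weight≈cost P x))
                                (sym (⟨⟩-+ˡ (coeff e) (coefficients P) (homogenise x)))

  -- Repeated squaring of assignments.

  Assignment : Set
  Assignment = ∀ u v → Maybe (Walk u v)

  -- The entry `A u v` fixes `P`, so one walk beats every `Q`. This walk may itself have more than
  -- `k` edges, and the entry is free if no walk from `u` to `v` has at most `k` edges.
  Optimal : ℕ → Point (suc d) → Assignment → Set
  Optimal k y A = ∀ u v (Q : Walk u v) → ∣ Q ∣ ≤ k → ∃[ P ] (A u v ≡ just P × cost P y ⊑ cost Q y)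

  direct : Assignment
  direct u v with u Fin.≟ v | T? (edge? u v)
  ... | yes ≡.refl | _     = just ε
  ... | no _       | yes e = just (e ◅ ε)
  ... | no _       | no _  = nothing

  -- There are no loops, so the empty walk is the only competitor on the diagonal; off the diagonal
  -- it is the single edge, if present.
  direct-optimal : ∀ y → Optimal 1 y direct
  direct-optimal y u _ ε _ with u Fin.≟ u | T? (edge? u u)
  ... | yes ≡.refl | _ = ε , ≡.refl , ⊑-reflexive refl
  ... | no u≢u     | _ = ⊥-elim (u≢u ≡.refl)
  direct-optimal y u v (e ◅ ε) _ with u Fin.≟ v | T? (edge? u v)
  ... | yes ≡.refl | _     = ⊥-elim (acyclic u [ e ])
  ... | no _       | no ∄e = ⊥-elim (∄e e)
  ... | no _       | yes f rewrite T-irrelevant f e = e ◅ ε , ≡.refl , ⊑-reflexive refl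
  direct-optimal y _ _ (e ◅ f ◅ P) (s≤s ())

  candidates : Assignment → ∀ u v → List (Walk u v)
  candidates A u v = mapMaybe (λ w → Maybe.zipWith _◅◅_ (A u w) (A w v)) (allFin n)

  candidates-length : ∀ A u v → length (candidates A u v) ≤ n
  candidates-length A u v = ℕ.≤-trans (length-mapMaybe _ (allFin n)) (ℕ.≤-reflexive (length-tabulate {n = n} _))

  ◅◅∈candidates : ∀ A {u w v} {P : Walk u w} {Q : Walk w v} →
                  A u w ≡ just P → A w v ≡ just Q → P ◅◅ Q ∈ candidates A u v
  ◅◅∈candidates A {u} {w} {v} {P} {Q} p q = Any.mapMaybe⁺ _ (allFin n) (Any.map⁺ (Any.map found (∈-allFin w)))
    where
    found : ∀ {w′} → w ≡ w′ → MaybeAny.Any (P ◅◅ Q ≡_) (Maybe.zipWith _◅◅_ (A u w′) (A w′ v))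
    found ≡.refl rewrite p | q = MaybeAny.just ≡.refl

  lightest : Point (suc d) → ∀ {u v} → List (Walk u v) → Maybe (Walk u v)
  lightest y []       = nothing
  lightest y (P ∷ Ps) = just (argmin (λ P → cost P y) P Ps)

  lightest-spec : ∀ y {u v} {Q : Walk u v} {Ps} → Q ∈ Ps →
                  ∃[ P ] (lightest y Ps ≡ just P × P ∈ Ps × cost P y ⊑ cost Q y)
  lightest-spec y {Q = Q} {P ∷ Ps} Q∈ = m , ≡.refl , m∈ , m≤ Q∈
    where
    f : Walk _ _ → Carrier
    f P = cost P y

    m : Walk _ _
    m = argmin f P Ps

    m∈ : m ∈ P ∷ Ps
    m∈ with argmin-sel f P Ps
    ... | inj₁ m≡P  = here m≡P
    ... | inj₂ m∈Ps = there m∈Ps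

    m≤ : Q ∈ P ∷ Ps → f m ⊑ f Q
    m≤ (here ≡.refl) = f[argmin]≤f[⊤] {f = f} P Ps
    m≤ (there Q∈Ps)  = All.lookup (f[argmin]≤f[xs] {f = f} P Ps) Q∈Ps

  difference : ∀ {u v} → Walk u v → Walk u v → Point (suc d)
  difference P Q i = coefficients P i + - 1# · coefficients Q i

  difference-cost : ∀ {u v} (P Q : Walk u v) y → ⟨ difference P Q , y ⟩ ≈ cost P y - cost Q y
  difference-cost P Q y = trans (⟨⟩-linˡ (- 1#) (coefficients P) (coefficients Q) y) (+-congˡ (-1*x≈-x _))

  comparisonsBetween : Assignment → Fin n → Fin n → List (Point (suc d))
  comparisonsBetween A u v = cartesianProductWith difference (candidates A u v) (candidates A u v)

  comparisons : Assignment → List (Point (suc d))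
  comparisons A = concatMap (λ u → concatMap (comparisonsBetween A u) (allFin n)) (allFin n)

  comparisons-length : ∀ A → length (comparisons A) ≤ n * (n * (n * n))
  comparisons-length A = sweep λ u → sweep λ v → ℕ.≤-trans
    (ℕ.≤-reflexive (length-cartesianProductWith _ (candidates A u v) (candidates A u v)))
    (ℕ.*-mono-≤ (candidates-length A u v) (candidates-length A u v))
    where
    sweep : ∀ {f : Fin n → List (Point (suc d))} {m} → (∀ u → length (f u) ≤ m) →
            length (concatMap f (allFin n)) ≤ n * m
    sweep {f} {m} f≤m = ≡.subst (λ l → length (concatMap f (allFin n)) ≤ l * m) (length-tabulate {n = n} _)
                          (length-concatMap f≤m (allFin n))

  difference∈comparisons : ∀ A {u v} {P Q : Walk u v} → P ∈ candidates A u v → Q ∈ candidates A u v →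
                           difference P Q ∈ comparisons A
  difference∈comparisons A {u} {v} P∈ Q∈ =
    ∈-concatMap⁺ _ (lose (∈-allFin u) (∈-concatMap⁺ (comparisonsBetween A u)
      (lose (∈-allFin v) (∈-cartesianProductWith⁺ difference P∈ Q∈))))

  square : Assignment → Point (suc d) → Assignment
  square A y u v = lightest y (candidates A u v)

  -- The walk selected at `y` and the concatenation through the midpoint of `Q` are both candidates,
  -- so their difference is among the comparisons and the verdict at `y` carries over to `x`. Hence
  -- a square computed at one representative serves its whole cell.
  square-optimal : ∀ {k A x y} → Optimal k x A → x ∼[ comparisons A ] y → Optimal (2 * k) x (square A y)
  square-optimal {k} {A} {x} {y} A-optimal (signs x∼y) u v Q ∣Q∣≤2k
    with w , Q₁ , Q₂ , ≡.refl , ∣Q₁∣≤k , ∣Q₂∣≤k ← split k Q ∣Q∣≤2k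
    with P₁ , eq₁ , P₁≤Q₁ ← A-optimal u w Q₁ ∣Q₁∣≤k
    with P₂ , eq₂ , P₂≤Q₂ ← A-optimal w v Q₂ (ℕ.≤-trans ∣Q₂∣≤k (ℕ.≤-reflexive (ℕ.+-identityʳ k)))
    with P₁P₂∈ ← ◅◅∈candidates A eq₁ eq₂
    with P , eq , P∈ , P≤P₁P₂ ← lightest-spec y P₁P₂∈ = P , eq , ⊑-trans P≤P₁P₂-at-x P₁P₂≤Q
    where
    P≤P₁P₂-at-x : cost P x ⊑ cost (P₁ ◅◅ P₂) x
    P≤P₁P₂-at-x = x-y⊑0⇒x⊑y (⊑-respˡ-≈ (difference-cost P (P₁ ◅◅ P₂) x)
      (Equivalence.from (All.lookup x∼y (difference∈comparisons A P∈ P₁P₂∈))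
        (⊑-respˡ-≈ (sym (difference-cost P (P₁ ◅◅ P₂) y)) (x⊑y⇒x-y⊑0 P≤P₁P₂))))

    P₁P₂≤Q : cost (P₁ ◅◅ P₂) x ⊑ cost (Q₁ ◅◅ Q₂) x
    P₁P₂≤Q = ⊑-respˡ-≈ (sym (cost-◅◅ P₁ P₂ x)) (⊑-respʳ-≈ (sym (cost-◅◅ Q₁ Q₂ x)) (+-mono-⊑ P₁≤Q₁ P₂≤Q₂))

  squares : Assignment → List Assignment
  squares A = map (square A) (proj₁ (representatives (comparisons A)))

  -- These are the leaves of a tree of depth `k`. The forms to compare depend on the assignment
  -- reached so far, so each node has its own arrangement, and the cell bounds multiply along the
  -- levels.
  assignments : ℕ → List Assignment
  assignments zero    = direct ∷ []
  assignments (suc k) = concatMap squares (assignments k)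

  assignments-optimal : ∀ k x → Any (Optimal (2 ^ k) x) (assignments k)
  assignments-optimal zero    x = here (direct-optimal x)
  assignments-optimal (suc k) x = Any.concatMap⁺ squares (Any.map optimal-square (assignments-optimal k x))
    where
    optimal-square : ∀ {A} → Optimal (2 ^ k) x A → Any (Optimal (2 ^ suc k) x) (squares A)
    optimal-square {A} A-optimal =
      Any.map⁺ (Any.map (square-optimal A-optimal) (proj₂ (proj₂ (representatives (comparisons A))) x))

  assignments-length : ∀ k → length (assignments k) ≤ (suc (n * (n * (n * n))) ^ suc d) ^ k
  assignments-length zero    = ℕ.≤-refl
  assignments-length (suc k) = ℕ.≤-trans (length-concatMap squares-length (assignments k))
    (ℕ.≤-trans (ℕ.*-monoˡ-≤ M (assignments-length k)) (ℕ.≤-reflexive (ℕ.*-comm (M ^ k) M)))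
    where
    M : ℕ
    M = suc (n * (n * (n * n))) ^ suc d

    squares-length : ∀ A → length (squares A) ≤ M
    squares-length A with Y , Y-length , _ ← representatives (comparisons A) =
      ℕ.≤-trans (ℕ.≤-reflexive (length-map (square A) Y))
        (ℕ.≤-trans Y-length (ℕ.^-monoˡ-≤ (suc d) (s≤s (comparisons-length A))))

  -- Small covers and minimum covers.

  smallCover : ∀ k → n ≤ 2 ^ k →
    ∃[ S ] (IsShortestPathCover ℝ G S × length S ≤ (suc (n * (n * (n * n))) ^ suc d) ^ k)
  smallCover k n≤2^k = S , record { unique = deduplicate-! _ S₀ ; covers = covers } ,
    ℕ.≤-trans (length-deduplicate _≟_ S₀) (ℕ.≤-trans (length-mapMaybe _ (assignments k)) (assignments-length k))
    where
    _≟_ : DecidableEquality (Walk s t)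
    P ≟ Q = em

    S₀ S : List (Walk s t)
    S₀ = mapMaybe (λ A → A s t) (assignments k)
    S  = deduplicate _≟_ S₀

    shortest : ∀ x {A} → Optimal (2 ^ k) (homogenise x) A → MaybeAny.Any (IsShortestAt ℝ G x) (A s t)
    shortest x A-optimal
      -- The given path shows that the entry at `s` and `t` is not `nothing`; since all paths have
      -- fewer than `n` edges, its walk then beats every one of them.
      with P , eq , _ ← A-optimal s t s-t-path (ℕ.≤-trans (ℕ.<⇒≤ (∣P∣<n s-t-path)) n≤2^k)
      rewrite eq = MaybeAny.just λ Q → lighter Q (A-optimal s t Q (ℕ.≤-trans (ℕ.<⇒≤ (∣P∣<n Q)) n≤2^k))
      where
      lighter : ∀ Q → ∃[ P′ ] (_ ≡ just P′ × cost P′ (homogenise x) ⊑ cost Q (homogenise x)) →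
                weight ℝ G P x ⊑ weight ℝ G Q x
      lighter Q (P′ , eq′ , P′≤Q) with ≡.refl ← just-injective (≡.trans (≡.sym eq) eq′) =
        ⊑-respˡ-≈ (sym (weight≈cost P x)) (⊑-respʳ-≈ (sym (weight≈cost Q x)) P′≤Q)

    covers : ∀ x → Any (IsShortestAt ℝ G x) S
    covers x with P , P∈ , P-shortest ← find (Any.mapMaybe⁺ _ (assignments k)
                   (Any.map⁺ (Any.map (shortest x) (assignments-optimal k (homogenise x))))) =
      lose (∈-deduplicate⁺ _≟_ P∈) P-shortest

  -- As long as a strictly shorter cover exists, it replaces the current one; `m` bounds the number
  -- of replacements.
  minimiseCover : ∀ m S → length S ≤ m → IsShortestPathCover ℝ G S →
                  ∃[ S′ ] (IsMSPC ℝ G S′ × length S′ ≤ length S)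
  minimiseCover m S ∣S∣≤m S-cover
    with em {∃[ S′ ] (IsShortestPathCover ℝ G S′ × length S′ < length S)}
  ... | no ∄S′ = S , record { isCover = S-cover
                            ; minimum = λ S′ S′-cover → ℕ.≮⇒≥ λ lt → ∄S′ (S′ , S′-cover , lt) } , ℕ.≤-refl
  minimiseCover zero S ∣S∣≤m S-cover | yes (S′ , S′-cover , lt) with () ← ℕ.≤-trans lt ∣S∣≤m
  minimiseCover (suc m) S ∣S∣≤m S-cover | yes (S′ , S′-cover , lt)
    with S″ , mspc , S″≤S′ ← minimiseCover m S′ (ℕ.s≤s⁻¹ (ℕ.≤-trans lt ∣S∣≤m)) S′-cover =
    S″ , mspc , ℕ.≤-trans S″≤S′ (ℕ.<⇒≤ lt)

-- Binary logarithms and the final exponent.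

floorLog₂ : ∀ n → 1 ≤ n → ∃[ k ] (2 ^ k ≤ n × n < 2 ^ suc k)
floorLog₂ (suc zero)    _ = 0 , ℕ.≤-refl , ℕ.≤-refl
floorLog₂ (suc (suc n)) _ with k , lo , hi ← floorLog₂ (suc n) (s≤s z≤n) | suc (suc n) ℕ.<? 2 ^ suc k
... | yes lt = k , ℕ.m≤n⇒m≤1+n lo , lt
-- Here `suc (suc n)` equals `2 ^ suc k`, so the logarithm goes up by one.
... | no nlt = suc k , ℕ.≮⇒≥ nlt , (begin
  2 ℕ.+ suc n                         ≤⟨ s≤s hi ⟩
  1 ℕ.+ 2 ^ suc k                     ≤⟨ ℕ.+-monoˡ-≤ (2 ^ suc k) (ℕ.m^n>0 2 (suc k)) ⟩
  2 ^ suc k ℕ.+ 2 ^ suc k             ≡⟨ ≡.cong (2 ^ suc k ℕ.+_) (ℕ.+-identityʳ (2 ^ suc k)) ⟨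
  2 ^ suc (suc k)                     ∎)
  where open ℕ.≤-Reasoning

2^-cancel-≤ : ∀ a b → 2 ^ a ≤ 2 ^ b → a ≤ b
2^-cancel-≤ a b p = ℕ.≮⇒≥ λ b<a → ℕ.<⇒≱ (ℕ.^-monoʳ-< 2 ℕ.≤-refl b<a) p

-- 2^k ≤ n and n^q ≤ 2^p give k q ≤ p, and 2 ≤ n gives q ≤ p, whence (k + 1) q ≤ 2 p.
cells-bound : ∀ n d k l → 2 ≤ n → 1 ≤ d → 2 ^ k ≤ n →
              l ≤ (suc (n * (n * (n * n))) ^ suc d) ^ suc k → l ≤ n ^[ 20 * d ·log₂]
cells-bound n d k l 2≤n 1≤d 2^k≤n l≤ p q _ n^q≤2^p = begin
  l ^ q                                               ≤⟨ ℕ.^-monoˡ-≤ q l≤ ⟩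
  ((suc (n * (n * (n * n))) ^ suc d) ^ suc k) ^ q     ≤⟨ ℕ.^-monoˡ-≤ q (ℕ.^-monoˡ-≤ (suc k)
                                                           (ℕ.^-monoˡ-≤ (suc d) 1+n⁴≤n⁵)) ⟩
  (((n ^ 5) ^ suc d) ^ suc k) ^ q                     ≡⟨ ≡.cong (λ m → (m ^ suc k) ^ q) (ℕ.^-*-assoc n 5 (suc d)) ⟩
  ((n ^ (5 * suc d)) ^ suc k) ^ q                     ≡⟨ ≡.cong (_^ q) (ℕ.^-*-assoc n (5 * suc d) (suc k)) ⟩
  (n ^ (5 * suc d * suc k)) ^ q                       ≡⟨ ℕ.^-*-assoc n (5 * suc d * suc k) q ⟩
  n ^ (5 * suc d * suc k * q)                         ≤⟨ ℕ.^-monoʳ-≤ n {{n≢0}} exponent ⟩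
  n ^ (20 * d * p)                                    ∎
  where
  open ℕ.≤-Reasoning

  n≢0 : ℕ.NonZero n
  n≢0 = ℕ.>-nonZero (ℕ.≤-trans (s≤s z≤n) 2≤n)

  1+n⁴≤n⁵ : suc (n * (n * (n * n))) ≤ n ^ 5
  1+n⁴≤n⁵ = begin
    suc (n * (n * (n * n)))     ≡⟨ ≡.cong (λ m → suc (n * (n * (n * m)))) (ℕ.*-identityʳ n) ⟨
    1 ℕ.+ n ^ 4                 ≤⟨ ℕ.+-monoˡ-≤ (n ^ 4) (ℕ.m^n>0 n {{n≢0}} 4) ⟩
    n ^ 4 ℕ.+ n ^ 4             ≡⟨ ≡.cong (n ^ 4 ℕ.+_) (ℕ.+-identityʳ (n ^ 4)) ⟨
    2 * n ^ 4                   ≤⟨ ℕ.*-monoˡ-≤ (n ^ 4) 2≤n ⟩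
    n ^ 5                       ∎

  q≤p : q ≤ p
  q≤p = 2^-cancel-≤ q p (ℕ.≤-trans (ℕ.^-monoˡ-≤ q 2≤n) n^q≤2^p)

  kq≤p : k * q ≤ p
  kq≤p = 2^-cancel-≤ (k * q) p (begin
    2 ^ (k * q)  ≡⟨ ℕ.^-*-assoc 2 k q ⟨
    (2 ^ k) ^ q  ≤⟨ ℕ.^-monoˡ-≤ q 2^k≤n ⟩
    n ^ q        ≤⟨ n^q≤2^p ⟩
    2 ^ p        ∎)

  -- The constant is 20 = 5 · 2 · 2: the 5 comes from `1+n⁴≤n⁵`, one 2 from `suc d ≤ d + d`, which
  -- uses `1 ≤ d`, and the other from `q + k * q ≤ p + p`.
  exponent : 5 * suc d * suc k * q ≤ 20 * d * p
  exponent = begin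
    5 * suc d * suc k * q        ≡⟨ ℕ.*-assoc (5 * suc d) (suc k) q ⟩
    5 * suc d * (q ℕ.+ k * q)    ≤⟨ ℕ.*-mono-≤ (ℕ.*-monoʳ-≤ 5 (ℕ.+-monoˡ-≤ d 1≤d)) (ℕ.+-mono-≤ q≤p kq≤p) ⟩
    5 * (d ℕ.+ d) * (p ℕ.+ p)    ≡⟨ solve 2 (λ d p → con 5 :* (d :+ d) :* (p :+ p) := con 20 :* d :* p) ≡.refl d p ⟩
    20 * d * p                   ∎

theorem2 : ExcludedMiddle 0ℓ → (ℝ : RealNumbers) →
    ∃[ C ] (0 < C × (∀ (n d : ℕ) → 2 ≤ n → 1 ≤ d → (G : ParametricDAG ℝ n d) →
    ∃[ S ] (IsMSPC ℝ G S × length S ≤ n ^[ C * d ·log₂])))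
theorem2 em ℝ = 20 , s≤s z≤n , λ n d 2≤n 1≤d G →
  let k , 2^k≤n , n<2^1+k    = floorLog₂ n (ℕ.<⇒≤ 2≤n)
      -- One squaring more than the rounded-down logarithm makes `2 ^ suc k` exceed `n`, and so the
      -- length of every path.
      S , S-cover , S-length = ShortestPaths.smallCover em ℝ G (suc k) (ℕ.<⇒≤ n<2^1+k)
      S′ , mspc , S′≤S       = ShortestPaths.minimiseCover em ℝ G (length S) S ℕ.≤-refl S-cover
  in S′ , mspc , cells-bound n d k (length S′) 2≤n 1≤d 2^k≤n (ℕ.≤-trans S′≤S S-length)
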